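{- Let $k\geq 2$. There is no $k$-geodetic digraph with minimum out-degree at least $2$ and order $M(2,k)+2$ (where $M(2,k)=1+2+\dots+2^k$) whose in-degree sequence is $(1,1,1,1,2,\dots,2,3,3,3,3)$, i.e. exactly four vertices have in-degree $1$, exactly four have in-degree $3$, and all others have in-degree $2$.
   Context: A digraph is $k$-geodetic if for any two vertices $u,v$ there is at most one directed walk from $u$ to $v$ of length at most $k$. The in-degree sequence is the list of in-degrees in non-decreasing order. -}

module Defs where

open import Data.Nat using (ℕ; zero; suc; _+_; _^_; _≤_)
open import Data.Fin using (Fin)
open import Data.Bool using (Bool; true; false; T; if_then_else_)
open import Data.List using (List; allFin; map; filter; length)
open import Data.Nat.ListAction using (sum)
open import Data.Product using (Σ; _×_; _,_)
open import Relation.Binary.PropositionalEquality using (_≡_)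
open import Data.Nat using (_≟_)

Digraph : ℕ → Set
Digraph n = Fin n → Fin n → Bool

data Walk {n : ℕ} (G : Digraph n) : Fin n → Fin n → ℕ → Set where
  stop : ∀ {u} → Walk G u u zero
  step : ∀ {u w v ℓ} → T (G u w) → Walk G w v ℓ → Walk G u v (suc ℓ)

-- k-geodetic: for any u v there is at most one directed walk from u to v
-- of length at most k (walks of different lengths count as different).
KGeodetic : ∀ {n} → ℕ → Digraph n → Set
KGeodetic {n} k G =
  ∀ (u v : Fin n) (ℓ ℓ' : ℕ) (p : Walk G u v ℓ) (q : Walk G u v ℓ') →
    ℓ ≤ k → ℓ' ≤ k → _≡_ {A = Σ ℕ (Walk G u v)} (ℓ , p) (ℓ' , q)

countV : ∀ {n} → (Fin n → Bool) → ℕ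
countV {n} P = sum (map (λ v → if P v then 1 else 0) (allFin n))

outdeg : ∀ {n} → Digraph n → Fin n → ℕ
outdeg G u = countV (λ v → G u v)

indeg : ∀ {n} → Digraph n → Fin n → ℕ
indeg G v = countV (λ u → G u v)

numInDeg : ∀ {n} → Digraph n → ℕ → ℕ
numInDeg {n} G d = length (filter (λ v → indeg G v ≟ d) (allFin n))

M : ℕ → ℕ → ℕ
M d zero = 1
M d (suc k) = M d k + d ^ suc k

{-# OPTIONS --safe #-}

-- Let A be the adjacency matrix, m = k + 1, n the order and S = I + A + ⋯ + A^k, which is a 0/1
-- matrix because G is k-geodetic. The in-degree sequence forces all out-degrees to be 2. The
-- entry (u, v) of AS = SA is at most ω(v) = min(2, indeg v), and each row of AS already sums to
-- 2 M(2,k) = ∑ ω, so every row of AS equals ω. Multiplying S − I + A^m = AS by A gives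
-- A^(m+i) = A^i + 2^(i-1) 1 ωᵀ for i ≥ 1, hence tr A^(m+i) = tr A^i + 2^(m+i) − 2^i. As G has no
-- closed walk of length 1, …, k, this yields tr A^j = 2^j − 2^c whenever c = j mod m ≠ 0.
-- Now let j = p be a prime with p > 2^m and p ≢ 0, 1 (mod m). Rotating closed walks shows that
-- p divides tr A^p, and 2^p ≡ 2 (mod p), so 2^c ≡ 2 (mod p), which is absurd for 1 < c < m.

module Submission where

open import Defs
open import Data.Nat using (ℕ; zero; suc; _+_; _*_; _^_; _≤_; _<_; z≤n; s≤s; _≟_; NonZero; _⊓_; _!)
open import Data.Nat.Properties hiding (_≟_)
open import Data.Nat.Divisibility
open import Data.Nat.DivMod
import Data.Nat.ListAction as ListAction
open import Data.Nat.ListAction using (product)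
open import Data.Nat.Primality using (Prime; euclidsLemma; ¬prime[0]; ¬prime[1]; prime⇒nonZero; prime⇒irreducible)
open import Data.Nat.Primality.Factorisation using (PrimeFactorisation; factors; factorise)
open import Data.Nat.Tactic.RingSolver using (solve-∀)
open import Data.Bool using (true; false; T; if_then_else_)
open import Data.Fin as Fin using (Fin; zero; suc; toℕ; fromℕ<; inject₁)
open import Data.Fin.Properties as Fin using (toℕ-fromℕ<; toℕ-injective; toℕ<n)
open import Data.Fin.Induction using (<-weakInduction)
open import Data.List using ([]; _∷_; map; filter; length; tabulate)
open import Data.List.Relation.Unary.All using (All; []; _∷_)
open import Data.Vec using (Vec; []; _∷_; _∷ʳ_; head; lookup; replicate)
open import Data.Vec.Properties using (≡-dec; ∷ʳ-injective)
open import Data.Product using (∃; _×_; _,_; proj₁; proj₂)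
open import Data.Sum using (_⊎_; inj₁; inj₂; [_,_]′)
open import Data.Empty using (⊥)
open import Function using (_∘_)
open import Relation.Nullary using (Dec; yes; no; does; ¬_; ¬?; contradiction)
open import Relation.Binary.Definitions using (tri<; tri≈; tri>)
open import Relation.Binary.PropositionalEquality hiding ([_])
open import Algebra.Properties.Semiring.Sum +-*-semiring

-- Indicators and finite sums.

𝟙 : ∀ {P : Set} → Dec P → ℕ
𝟙 P? = if does P? then 1 else 0

𝟙-true : ∀ {P : Set} (P? : Dec P) → P → 𝟙 P? ≡ 1
𝟙-true (yes _) _ = refl
𝟙-true (no ¬p) p = contradiction p ¬p

𝟙-false : ∀ {P : Set} (P? : Dec P) → ¬ P → 𝟙 P? ≡ 0
𝟙-false (yes p) ¬p = contradiction p ¬p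
𝟙-false (no _)  _  = refl

𝟙-cong : ∀ {P Q : Set} (P? : Dec P) (Q? : Dec Q) → (P → Q) → (Q → P) → 𝟙 P? ≡ 𝟙 Q?
𝟙-cong (yes p) Q? f g = sym (𝟙-true Q? (f p))
𝟙-cong (no ¬p) Q? f g = sym (𝟙-false Q? (¬p ∘ g))

*𝟙-split : ∀ {P : Set} x (P? : Dec P) → x ≡ x * 𝟙 P? + x * 𝟙 (¬? P?)
*𝟙-split x (yes _) = sym (trans (cong₂ _+_ (*-identityʳ x) (*-zeroʳ x)) (+-identityʳ x))
*𝟙-split x (no _)  = sym (cong₂ _+_ (*-zeroʳ x) (*-identityʳ x))

*𝟙≢0⇒≢0 : ∀ {P : Set} {x} (P? : Dec P) → x * 𝟙 P? ≢ 0 → x ≢ 0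
*𝟙≢0⇒≢0 P? nz refl = nz refl

*𝟙≢0⇒true : ∀ {P : Set} x (P? : Dec P) → x * 𝟙 P? ≢ 0 → P
*𝟙≢0⇒true x (yes p) nz = p
*𝟙≢0⇒true x (no _)  nz = contradiction (*-zeroʳ x) nz

-- Where the indicator is nonzero `e` equals `c`, so a fixed multiplier `c` can be traded for the
-- varying quantity `e`, later a letter count.
*𝟙≟-comm : ∀ x e {c} → c * (x * 𝟙 (e ≟ c)) ≡ x * 𝟙 (e ≟ c) * e
*𝟙≟-comm x e {c} with e ≟ c
... | yes refl = *-comm e (x * 𝟙 (e ≟ e))
... | no  e≢c  rewrite 𝟙-false (e ≟ c) e≢c | *-zeroʳ x = *-zeroʳ c

sum-mono-≤ : ∀ {n} {f g : Fin n → ℕ} → (∀ i → f i ≤ g i) → sum f ≤ sum g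
sum-mono-≤ {zero}  f≤g = z≤n
sum-mono-≤ {suc n} f≤g = +-mono-≤ (f≤g zero) (sum-mono-≤ (f≤g ∘ suc))

-- The totals leave no slack for a strict inequality at any index. This turns bounds into equalities
-- both for out-degrees and for the rows of `A ⊗ powerSum A k`.
sum-mono-≡ : ∀ {n} {f g : Fin n → ℕ} → (∀ i → f i ≤ g i) → sum g ≤ sum f → ∀ i → f i ≡ g i
sum-mono-≡ {suc n} {f} {g} f≤g G≤F zero = ≤-antisym (f≤g zero)
  (+-cancelʳ-≤ (sum (g ∘ suc)) (g zero) (f zero)
    (≤-trans G≤F (+-monoʳ-≤ (f zero) (sum-mono-≤ (f≤g ∘ suc)))))
sum-mono-≡ {suc n} {f} {g} f≤g G≤F (suc i) = sum-mono-≡ (f≤g ∘ suc)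
  (+-cancelˡ-≤ (g zero) _ _ (≤-trans G≤F (+-monoˡ-≤ (sum (f ∘ suc)) (f≤g zero)))) i

sum-zero : ∀ {n} {f : Fin n → ℕ} → (∀ i → f i ≡ 0) → sum f ≡ 0
sum-zero {n} f≡0 = trans (sum-cong-≗ f≡0) (sum-replicate-zero n)

sum-single : ∀ {n} {f : Fin n → ℕ} u → (∀ i → i ≢ u → f i ≡ 0) → sum f ≡ f u
sum-single {f = f} zero    f≡0 =
  trans (cong (f zero +_) (sum-zero λ i → f≡0 (suc i) λ ())) (+-identityʳ (f zero))
sum-single {f = f} (suc u) f≡0 = cong₂ _+_ (f≡0 zero λ ())
  (sum-single u λ i i≢u → f≡0 (suc i) (i≢u ∘ Fin.suc-injective))

sum-const : ∀ n c → ∑[ i < n ] c ≡ n * c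
sum-const zero    c = refl
sum-const (suc n) c = cong (c +_) (sum-const n c)

∣-sum : ∀ {n d} {f : Fin n → ℕ} → (∀ i → d ∣ f i) → d ∣ sum f
∣-sum {zero}  d∣f = _ ∣0
∣-sum {suc n} d∣f = ∣m∣n⇒∣m+n (d∣f zero) (∣-sum (d∣f ∘ suc))

-- Fermat's congruence for words

module _ {N : ℕ} where

  Word : ℕ → Set
  Word = Vec (Fin N)

  ∑ʷ : ∀ p → (Word p → ℕ) → ℕ
  ∑ʷ zero    F = F []
  ∑ʷ (suc p) F = ∑[ x < N ] ∑ʷ p (F ∘ (x ∷_))

  ∑ʷ-cong : ∀ p {F H : Word p → ℕ} → (∀ w → F w ≡ H w) → ∑ʷ p F ≡ ∑ʷ p H
  ∑ʷ-cong zero    F≡H = F≡H []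
  ∑ʷ-cong (suc p) F≡H = sum-cong-≗ λ x → ∑ʷ-cong p (F≡H ∘ (x ∷_))

  ∑ʷ-zero : ∀ p {F : Word p → ℕ} → (∀ w → F w ≡ 0) → ∑ʷ p F ≡ 0
  ∑ʷ-zero zero    F≡0 = F≡0 []
  ∑ʷ-zero (suc p) F≡0 = sum-zero λ x → ∑ʷ-zero p (F≡0 ∘ (x ∷_))

  ∑ʷ-single : ∀ p {F : Word p → ℕ} u → (∀ w → w ≢ u → F w ≡ 0) → ∑ʷ p F ≡ F u
  ∑ʷ-single zero    []      F≡0 = refl
  ∑ʷ-single (suc p) (y ∷ u) F≡0 = trans
    (sum-single y λ x x≢y → ∑ʷ-zero p λ w → F≡0 (x ∷ w) λ { refl → x≢y refl })
    (∑ʷ-single p u λ w w≢u → F≡0 (y ∷ w) λ { refl → w≢u refl })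

  ∑ʷ-distrib-+ : ∀ p (F H : Word p → ℕ) → ∑ʷ p (λ w → F w + H w) ≡ ∑ʷ p F + ∑ʷ p H
  ∑ʷ-distrib-+ zero    F H = refl
  ∑ʷ-distrib-+ (suc p) F H = trans
    (sum-cong-≗ λ x → ∑ʷ-distrib-+ p (F ∘ (x ∷_)) (H ∘ (x ∷_)))
    (∑-distrib-+ (λ x → ∑ʷ p (F ∘ (x ∷_))) λ x → ∑ʷ p (H ∘ (x ∷_)))

  *-distribˡ-∑ʷ : ∀ p c (F : Word p → ℕ) → c * ∑ʷ p F ≡ ∑ʷ p λ w → c * F w
  *-distribˡ-∑ʷ zero    c F = refl
  *-distribˡ-∑ʷ (suc p) c F = trans (*-distribˡ-sum c λ x → ∑ʷ p (F ∘ (x ∷_)))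
    (sum-cong-≗ λ x → *-distribˡ-∑ʷ p c (F ∘ (x ∷_)))

  ∑ʷ-sum-comm : ∀ p {n} (F : Word p → Fin n → ℕ) →
    ∑ʷ p (λ w → sum (F w)) ≡ ∑[ i < n ] ∑ʷ p (λ w → F w i)
  ∑ʷ-sum-comm zero    F = refl
  ∑ʷ-sum-comm (suc p) F = trans (sum-cong-≗ λ x → ∑ʷ-sum-comm p (F ∘ (x ∷_)))
    (∑-comm λ x i → ∑ʷ p λ w → F (x ∷ w) i)

  ∑ʷ-const : ∀ p c → ∑ʷ p (λ _ → c) ≡ N ^ p * c
  ∑ʷ-const zero    c = sym (+-identityʳ c)
  ∑ʷ-const (suc p) c = trans (sum-cong-≗ λ (_ : Fin N) → ∑ʷ-const p c)
    (trans (sum-const N (N ^ p * c)) (sym (*-assoc N (N ^ p) c)))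

  -- Summing over the last letter first only exchanges finite sums. Since `rotate (x ∷ w)` is
  -- `w ∷ʳ x`, this is exactly the invariance of `∑ʷ` under rotation.
  ∑ʷ-∷ʳ : ∀ p (F : Word (suc p) → ℕ) → ∑ʷ (suc p) F ≡ ∑[ x < N ] ∑ʷ p (λ w → F (w ∷ʳ x))
  ∑ʷ-∷ʳ zero    F = refl
  ∑ʷ-∷ʳ (suc p) F = trans (sum-cong-≗ λ y → ∑ʷ-∷ʳ p (F ∘ (y ∷_)))
    (∑-comm λ y x → ∑ʷ p λ w → F (y ∷ (w ∷ʳ x)))

  rotate : ∀ {q} → Word (suc q) → Word (suc q)
  rotate (x ∷ w) = w ∷ʳ x

  ∑ʷ-rotate : ∀ q (F : Word (suc q) → ℕ) → ∑ʷ (suc q) (F ∘ rotate) ≡ ∑ʷ (suc q) F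
  ∑ʷ-rotate q F = sym (∑ʷ-∷ʳ q F)

  RotationInvariant : ∀ {q} → (Word (suc q) → ℕ) → Set
  RotationInvariant F = ∀ w → F (rotate w) ≡ F w

  count : ∀ {p} → Fin N → Word p → ℕ
  count {p} a w = ∑[ i < p ] 𝟙 (lookup w i Fin.≟ a)

  count-∷ʳ : ∀ {p} a (w : Word p) x → count a (w ∷ʳ x) ≡ 𝟙 (x Fin.≟ a) + count a w
  count-∷ʳ a []      x = refl
  count-∷ʳ a (y ∷ w) x = trans (cong (𝟙 (y Fin.≟ a) +_) (count-∷ʳ a w x))
    (+-swap (𝟙 (y Fin.≟ a)) (𝟙 (x Fin.≟ a)) (count a w))
    where
    +-swap : ∀ k l m → k + (l + m) ≡ l + (k + m)
    +-swap = solve-∀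

  count-rotate : ∀ {q} a (w : Word (suc q)) → count a (rotate w) ≡ count a w
  count-rotate a (x ∷ w) = count-∷ʳ a w x

  count≤length : ∀ {p} a (w : Word p) → count a w ≤ p
  count≤length a []      = z≤n
  count≤length a (x ∷ w) with x Fin.≟ a
  ... | yes _ = s≤s (count≤length a w)
  ... | no  _ = m≤n⇒m≤1+n (count≤length a w)

  count≡length⇒constant : ∀ {p} a (w : Word p) → count a w ≡ p → w ≡ replicate p a
  count≡length⇒constant a []      _  = refl
  count≡length⇒constant a (x ∷ w) eq with x Fin.≟ a
  ... | yes refl = cong (a ∷_) (count≡length⇒constant a w (suc-injective eq))
  ... | no  _    = contradiction (subst (_≤ _) eq (count≤length a w)) 1+n≰n

  count-head≢0 : ∀ {q} (w : Word (suc q)) → count (head w) w ≢ 0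
  count-head≢0 (x ∷ w) eq with x Fin.≟ x | eq
  ... | yes _  | ()
  ... | no x≢x | _ = x≢x refl

  lookup-∷ʳ-inject₁ : ∀ {p} (w : Word p) x i → lookup (w ∷ʳ x) (inject₁ i) ≡ lookup w i
  lookup-∷ʳ-inject₁ (y ∷ w) x zero    = refl
  lookup-∷ʳ-inject₁ (y ∷ w) x (suc i) = lookup-∷ʳ-inject₁ w x i

  -- The letter at position `suc i` of a word stands at position `i` of its rotation, so rotating
  -- moves the marked position down to the front one step at a time.
  ∑ʷ-position : ∀ {q} (F : Word (suc q) → ℕ) → RotationInvariant F → ∀ a i →
    ∑ʷ (suc q) (λ w → F w * 𝟙 (lookup w i Fin.≟ a)) ≡ ∑ʷ (suc q) (λ w → F w * 𝟙 (lookup w zero Fin.≟ a))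
  ∑ʷ-position {q} F inv a = <-weakInduction
    (λ i → ∑ʷ (suc q) (at i) ≡ ∑ʷ (suc q) λ w → F w * 𝟙 (lookup w zero Fin.≟ a))
    refl
    λ i ih → trans (∑ʷ-cong (suc q) {at (suc i)} (shift i)) (trans (∑ʷ-rotate q (at (inject₁ i))) ih)
    where
    at : Fin (suc q) → Word (suc q) → ℕ
    at i w = F w * 𝟙 (lookup w i Fin.≟ a)

    shift : ∀ i w → at (suc i) w ≡ at (inject₁ i) (rotate w)
    shift i (x ∷ w) = cong₂ _*_ (sym (inv (x ∷ w)))
      (cong (λ y → 𝟙 (y Fin.≟ a)) (sym (lookup-∷ʳ-inject₁ w x i)))

  -- Double counting of pairs of a word and a position holding `a`: each of the `suc q` positions
  -- contributes the same amount.
  ∑ʷ-count : ∀ {q} (F : Word (suc q) → ℕ) → RotationInvariant F → ∀ a →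
    ∑ʷ (suc q) (λ w → F w * count a w) ≡ suc q * ∑ʷ (suc q) (λ w → F w * 𝟙 (lookup w zero Fin.≟ a))
  ∑ʷ-count {q} F inv a = begin
    ∑ʷ (suc q) (λ w → F w * count a w)
      ≡⟨ (∑ʷ-cong (suc q) λ w → *-distribˡ-sum (F w) λ i → 𝟙 (lookup w i Fin.≟ a)) ⟩
    ∑ʷ (suc q) (λ w → ∑[ i < suc q ] (F w * 𝟙 (lookup w i Fin.≟ a)))
      ≡⟨ ∑ʷ-sum-comm (suc q) (λ w i → F w * 𝟙 (lookup w i Fin.≟ a)) ⟩
    ∑[ i < suc q ] ∑ʷ (suc q) (λ w → F w * 𝟙 (lookup w i Fin.≟ a))
      ≡⟨ sum-cong-≗ (∑ʷ-position F inv a) ⟩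
    ∑[ i < suc q ] ∑ʷ (suc q) (λ w → F w * 𝟙 (lookup w zero Fin.≟ a))
      ≡⟨ sum-const (suc q) _ ⟩
    suc q * ∑ʷ (suc q) (λ w → F w * 𝟙 (lookup w zero Fin.≟ a)) ∎
    where open ≡-Reasoning

  module _ {q} (pr : Prime (suc q)) where

    private p = suc q

    -- Marking one of the c occurrences of a and rotating it to the front gives
    -- c ∑_{count a w = c} F(w) = p ∑_{count a w = c, w₀ = a} F(w).
    prime∣∑ʷ-count≡ : ∀ (F : Word p → ℕ) → RotationInvariant F → ∀ a {c} → c ≢ 0 → c < p →
      p ∣ ∑ʷ p (λ w → F w * 𝟙 (count a w ≟ c))
    prime∣∑ʷ-count≡ F inv a {zero}  c≢0 c<p = contradiction refl c≢0
    prime∣∑ʷ-count≡ F inv a {c@(suc _)} c≢0 c<p =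
      -- As `0 < c < p`, the prime `p` does not divide `c`, so by Euclid's lemma it divides the
      -- other factor.
      [ (λ p∣c → contradiction (∣⇒≤ p∣c) (<⇒≱ c<p)) , (λ d → d) ]′
        (euclidsLemma c (∑ʷ p H) pr (subst (p ∣_) (sym c*∑) (m∣m*n _)))
      where
      H : Word p → ℕ
      H w = F w * 𝟙 (count a w ≟ c)

      H-inv : RotationInvariant H
      H-inv w = cong₂ _*_ (inv w) (cong (λ e → 𝟙 (e ≟ c)) (count-rotate a w))

      c*∑ : c * ∑ʷ p H ≡ p * ∑ʷ p (λ w → H w * 𝟙 (lookup w zero Fin.≟ a))
      c*∑ = trans (*-distribˡ-∑ʷ p c H) (trans (∑ʷ-cong p λ w → *𝟙≟-comm (F w) (count a w) {c}) (∑ʷ-count H H-inv a))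

    -- Words are sorted by their number of occurrences of `a`. On the support of `F` this number is
    -- below `p`, so `Fin p` indexes all classes; class 0 vanishes and each other class is a
    -- multiple of `p`.
    prime∣∑ʷ-proper-count : ∀ (F : Word p → ℕ) → RotationInvariant F → ∀ a →
      (∀ w → F w ≢ 0 → count a w ≢ 0 × count a w < p) → p ∣ ∑ʷ p F
    prime∣∑ʷ-proper-count F inv a proper = subst (p ∣_)
      (sym (trans (∑ʷ-cong p by-count) (∑ʷ-sum-comm p λ w (c : Fin p) → F w * 𝟙 (count a w ≟ toℕ c))))
      (∣-sum class)
      where
      by-count : ∀ w → F w ≡ ∑[ c < p ] (F w * 𝟙 (count a w ≟ toℕ c))
      by-count w with F w ≟ 0
      ... | yes F≡0 rewrite F≡0 = sym (sum-replicate-zero p)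
      ... | no  F≢0 = sym (trans
        (sum-single c λ i i≢c → trans
          (cong (F w *_) (𝟙-false (count a w ≟ toℕ i) λ eq →
            i≢c (toℕ-injective (trans (sym eq) (sym toℕ-c)))))
          (*-zeroʳ (F w)))
        (trans (cong (F w *_) (𝟙-true (count a w ≟ toℕ c) (sym toℕ-c))) (*-identityʳ (F w))))
        where
        c : Fin p
        c = fromℕ< (proj₂ (proper w F≢0))
        toℕ-c : toℕ c ≡ count a w
        toℕ-c = toℕ-fromℕ< (proj₂ (proper w F≢0))

      class : ∀ c → p ∣ ∑ʷ p (λ w → F w * 𝟙 (count a w ≟ toℕ c))
      class zero    = subst (p ∣_) (sym (∑ʷ-zero p vanish)) (p ∣0)
        where
        vanish : ∀ w → F w * 𝟙 (count a w ≟ 0) ≡ 0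
        vanish w with F w * 𝟙 (count a w ≟ 0) ≟ 0
        ... | yes eq = eq
        ... | no  nz = contradiction (*𝟙≢0⇒true (F w) (count a w ≟ 0) nz)
          (proj₁ (proper w (*𝟙≢0⇒≢0 (count a w ≟ 0) nz)))
      class c@(suc _) = prime∣∑ʷ-count≡ F inv a (λ ()) (toℕ<n c)

    -- Induction on the alphabet: words are split by whether they contain the last letter.
    prime∣∑ʷ-letters< : ∀ t → t ≤ N → ∀ (F : Word p → ℕ) → RotationInvariant F →
      (∀ x → F (replicate p x) ≡ 0) →
      (∀ w b → F w ≢ 0 → t ≤ toℕ b → count b w ≡ 0) → p ∣ ∑ʷ p F
    -- No letter may occur in a word of the support, but the length `p` is positive, so the first
    -- letter does occur and the support is empty.
    prime∣∑ʷ-letters< zero _ F inv F-const supp = subst (p ∣_) (sym (∑ʷ-zero p vanish)) (p ∣0)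
      where
      vanish : ∀ w → F w ≡ 0
      vanish w with F w ≟ 0
      ... | yes eq = eq
      ... | no  nz = contradiction (supp w (head w) nz z≤n) (count-head≢0 w)
    prime∣∑ʷ-letters< (suc t) t<N F inv F-const supp = subst (p ∣_)
      (sym (trans (∑ʷ-cong p λ w → *𝟙-split (F w) (count a w ≟ 0)) (∑ʷ-distrib-+ p F₀ F₁)))
      (∣m∣n⇒∣m+n
        (prime∣∑ʷ-letters< t (<⇒≤ t<N) F₀
          (λ w → cong₂ _*_ (inv w) (cong (λ e → 𝟙 (e ≟ 0)) (count-rotate a w)))
          (λ x → cong (_* 𝟙 (count a (replicate p x) ≟ 0)) (F-const x))
          supp₀)
        (prime∣∑ʷ-proper-count F₁
          (λ w → cong₂ _*_ (inv w) (cong (λ e → 𝟙 (¬? (e ≟ 0))) (count-rotate a w)))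
          a proper))
      where
      a : Fin N
      a = fromℕ< t<N

      F₀ F₁ : Word p → ℕ
      F₀ w = F w * 𝟙 (count a w ≟ 0)
      F₁ w = F w * 𝟙 (¬? (count a w ≟ 0))

      supp₀ : ∀ w b → F₀ w ≢ 0 → t ≤ toℕ b → count b w ≡ 0
      supp₀ w b nz t≤b with m≤n⇒m<n∨m≡n t≤b
      ... | inj₁ t<b  = supp w b (*𝟙≢0⇒≢0 (count a w ≟ 0) nz) t<b
      ... | inj₂ refl = subst (λ b → count b w ≡ 0) (toℕ-injective (toℕ-fromℕ< t<N))
        (*𝟙≢0⇒true (F w) (count a w ≟ 0) nz)

      proper : ∀ w → F₁ w ≢ 0 → count a w ≢ 0 × count a w < p
      -- A word with `p` occurrences of `a` would be constant, and `F` vanishes on constant words.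
      proper w nz = *𝟙≢0⇒true (F w) (¬? (count a w ≟ 0)) nz ,
        ≤∧≢⇒< (count≤length a w) λ eq → *𝟙≢0⇒≢0 (¬? (count a w ≟ 0)) nz
          (trans (cong F (count≡length⇒constant a w eq)) (F-const a))

    constant? : (w : Word p) → Dec (w ≡ replicate p (head w))
    constant? w = ≡-dec Fin._≟_ w (replicate p (head w))

    replicate-∷ʳ : ∀ {r} (x : Fin N) → replicate r x ∷ʳ x ≡ replicate (suc r) x
    replicate-∷ʳ {zero}  x = refl
    replicate-∷ʳ {suc r} x = cong (x ∷_) (replicate-∷ʳ x)

    rotate-constant : ∀ w → w ≡ replicate p (head w) → rotate w ≡ replicate p (head (rotate w))
    rotate-constant w eq = subst (λ v → rotate v ≡ replicate p (head (rotate v))) (sym eq)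
      (trans (replicate-∷ʳ x) (cong (replicate p ∘ head) (sym (replicate-∷ʳ {q} x))))
      where x = head w

    constant-rotate : ∀ w → rotate w ≡ replicate p (head (rotate w)) → w ≡ replicate p (head w)
    constant-rotate (x ∷ w) eq with ∷ʳ-injective w _ (trans eq (sym (replicate-∷ʳ _)))
    ... | w≡ , x≡ = cong (x ∷_) (trans w≡ (cong (replicate _) (sym x≡)))

    -- Constant words are split off; the remaining weight is still rotation invariant and vanishes
    -- on constant words, so it sums to a multiple of `p`.
    ∑ʷ-fermat : ∀ (F : Word p → ℕ) → RotationInvariant F →
      ∃ λ e → ∑ʷ p F ≡ e * p + ∑[ x < N ] F (replicate p x)
    -- The induction on letters is entered at `t = N`: every letter is below `N`, so the support
    -- condition holds.
    ∑ʷ-fermat F inv with prime∣∑ʷ-letters< N ≤-refl F≢ F≢-inv F≢-const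
                           (λ w b _ N≤b → contradiction N≤b (<⇒≱ (toℕ<n b)))
      where
      F≢ : Word p → ℕ
      F≢ w = F w * 𝟙 (¬? (constant? w))

      F≢-inv : RotationInvariant F≢
      F≢-inv w = cong₂ _*_ (inv w) (𝟙-cong (¬? (constant? (rotate w))) (¬? (constant? w))
        (_∘ rotate-constant w) (_∘ constant-rotate w))

      F≢-const : ∀ x → F≢ (replicate p x) ≡ 0
      F≢-const x = trans
        (cong (F (replicate p x) *_) (𝟙-false (¬? (constant? (replicate p x))) λ ¬c → ¬c refl))
        (*-zeroʳ (F (replicate p x)))
    ... | divides e eq = e , (begin
      ∑ʷ p F
        ≡⟨ ∑ʷ-cong p (λ w → *𝟙-split (F w) (constant? w)) ⟩
      ∑ʷ p (λ w → F w * 𝟙 (constant? w) + F w * 𝟙 (¬? (constant? w)))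
        ≡⟨ ∑ʷ-distrib-+ p (λ w → F w * 𝟙 (constant? w)) (λ w → F w * 𝟙 (¬? (constant? w))) ⟩
      ∑ʷ p (λ w → F w * 𝟙 (constant? w)) + ∑ʷ p (λ w → F w * 𝟙 (¬? (constant? w)))
        ≡⟨ cong₂ _+_ (sum-cong-≗ only-constant) eq ⟩
      ∑[ x < N ] F (replicate p x) + e * p
        ≡⟨ +-comm (∑[ x < N ] F (replicate p x)) (e * p) ⟩
      e * p + ∑[ x < N ] F (replicate p x) ∎)
      where
      open ≡-Reasoning
      only-constant : ∀ x → ∑ʷ q (λ w → F (x ∷ w) * 𝟙 (constant? (x ∷ w))) ≡ F (replicate p x)
      only-constant x = trans
        (∑ʷ-single q (replicate q x) λ w w≢ → trans
          (cong (F (x ∷ w) *_) (𝟙-false (constant? (x ∷ w)) λ { refl → w≢ refl }))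
          (*-zeroʳ (F (x ∷ w))))
        (trans (cong (F (replicate p x) *_) (𝟙-true (constant? (replicate p x)) refl))
          (*-identityʳ _))

-- Primes outside the residue class of 1

-- Residue 1 is closed under products, so a number outside this class has a prime factor outside it.
prime-factor≢1-mod : ∀ {m N} .{{_ : NonZero m}} .{{_ : NonZero N}} → 1 < m → N % m ≢ 1 →
  ∃ λ p → Prime p × p ∣ N × p % m ≢ 1
prime-factor≢1-mod {m} {N} 1<m N≢1 = search (factors fs) (PrimeFactorisation.factorsPrime fs)
  (∣-reflexive (sym (PrimeFactorisation.isFactorisation fs)))
  (N≢1 ∘ trans (cong (_% m) (PrimeFactorisation.isFactorisation fs)))
  where
  fs = factorise N

  search : ∀ ps → All Prime ps → product ps ∣ N → product ps % m ≢ 1 →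
    ∃ λ p → Prime p × p ∣ N × p % m ≢ 1
  search []       _          _  1≢1 = contradiction (m<n⇒m%n≡m 1<m) 1≢1
  search (p ∷ ps) (pr ∷ prs) ∣N ≢1 with p % m ≟ 1
  ... | no  p≢1 = p , pr , m*n∣⇒m∣ p (product ps) ∣N , p≢1
  ... | yes p≡1 = search ps prs (m*n∣⇒n∣ p (product ps) ∣N) λ ps≡1 → ≢1 (begin
    p * product ps % m               ≡⟨ %-distribˡ-* p (product ps) m ⟩
    (p % m) * (product ps % m) % m   ≡⟨ cong₂ (λ a b → a * b % m) p≡1 ps≡1 ⟩
    1 % m                            ≡⟨ m<n⇒m%n≡m 1<m ⟩
    1                                ∎)
    where open ≡-Reasoning

-- Euclid's argument applied to m K! − 1 ≡ −1 (mod m).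
large-prime≢1-mod : ∀ m K .{{_ : NonZero m}} → 2 < m →
  ∃ λ p → Prime p × K < p × p % m ≢ 1
large-prime≢1-mod m K 2<m with m * K ! in eq
... | zero = contradiction (m*n≡0⇒m≡0∨n≡0 m eq)
  [ (λ m≡0 → <⇒≱ 2<m (subst (_≤ 2) (sym m≡0) z≤n)) , (λ K!≡0 → <⇒≢ (1≤n! K) (sym K!≡0)) ]′
... | suc zero = contradiction (m*n≡1⇒m≡1 m (K !) eq) λ m≡1 → <⇒≱ 2<m (subst (_≤ 2) (sym m≡1) (s≤s z≤n))
-- Here `N` is `m * K ! - 1`; the pattern also records that it is nonzero.
... | suc N@(suc _) with prime-factor≢1-mod {m} {N} (<⇒≤ 2<m) N≢1
  where
  N≢1 : N % m ≢ 1
  -- Otherwise `suc N`, a multiple of `m`, would leave remainder 2; this is where `2 < m` enters.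
  N≢1 N≡1 = contradiction (begin
    0                        ≡⟨ n∣m⇒m%n≡0 (suc N) m (subst (m ∣_) eq (m∣m*n (K !))) ⟨
    suc N % m                ≡⟨ %-distribˡ-+ 1 N m ⟩
    (1 % m + N % m) % m      ≡⟨ cong₂ (λ a b → (a + b) % m) (m<n⇒m%n≡m (<⇒≤ 2<m)) N≡1 ⟩
    2 % m                    ≡⟨ m<n⇒m%n≡m 2<m ⟩
    2                        ∎) λ ()
    where open ≡-Reasoning
... | p , pr , p∣N , p≢1 = p , pr , ≰⇒> p≰K , p≢1
  where
  p∣p! : ∀ r → Prime r → r ∣ r !
  p∣p! zero    r-prime = contradiction r-prime ¬prime[0]
  p∣p! (suc r) _ = m∣m*n (r !)

  p≰K : ¬ p ≤ K
  -- A prime `p ≤ K` divides `K !`, hence both `N` and `N + 1`, hence 1.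
  p≰K p≤K = ¬prime[1] (subst Prime (∣1⇒≡1 (∣m+n∣m⇒∣n
    (subst (p ∣_) (trans eq (+-comm 1 N)) (∣n⇒∣m*n m (∣-trans (p∣p! p pr) (m≤n⇒m!∣n! p≤K)))) p∣N)) pr)

-- Powers of the adjacency matrix

Matrix : ℕ → Set
Matrix n = Fin n → Fin n → ℕ

infixl 7 _⊗_
_⊗_ : ∀ {n} → Matrix n → Matrix n → Matrix n
_⊗_ {n} A B u v = ∑[ w < n ] (A u w * B w v)

Id : ∀ {n} → Matrix n
Id u v = 𝟙 (u Fin.≟ v)

⊗-congʳ : ∀ {n} (A B C : Matrix n) → (∀ u v → B u v ≡ C u v) → ∀ u v → (A ⊗ B) u v ≡ (A ⊗ C) u v
⊗-congʳ A B C B≡C u v = sum-cong-≗ λ w → cong (A u w *_) (B≡C w v)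

⊗-identityˡ : ∀ {n} (A : Matrix n) u v → (Id ⊗ A) u v ≡ A u v
⊗-identityˡ A u v = trans
  (sum-single u λ w w≢u → cong (_* A w v) (𝟙-false (u Fin.≟ w) (w≢u ∘ sym)))
  (trans (cong (_* A u v) (𝟙-true (u Fin.≟ u) refl)) (*-identityˡ (A u v)))

⊗-identityʳ : ∀ {n} (A : Matrix n) u v → (A ⊗ Id) u v ≡ A u v
⊗-identityʳ A u v = trans
  (sum-single v λ w w≢v → trans (cong (A u w *_) (𝟙-false (w Fin.≟ v) w≢v)) (*-zeroʳ (A u w)))
  (trans (cong (A u v *_) (𝟙-true (v Fin.≟ v) refl)) (*-identityʳ (A u v)))

⊗-assoc : ∀ {n} (A B C : Matrix n) u v → (A ⊗ (B ⊗ C)) u v ≡ ((A ⊗ B) ⊗ C) u v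
⊗-assoc A B C u v = begin
  (A ⊗ (B ⊗ C)) u v
    ≡⟨ sum-cong-≗ (λ w → *-distribˡ-sum (A u w) λ x → B w x * C x v) ⟩
  ∑[ w < _ ] ∑[ x < _ ] (A u w * (B w x * C x v))
    ≡⟨ ∑-comm (λ w x → A u w * (B w x * C x v)) ⟩
  ∑[ x < _ ] ∑[ w < _ ] (A u w * (B w x * C x v))
    ≡⟨ (sum-cong-≗ λ x → sum-cong-≗ λ w → *-assoc (A u w) (B w x) (C x v)) ⟨
  ∑[ x < _ ] ∑[ w < _ ] (A u w * B w x * C x v)
    ≡⟨ (sum-cong-≗ λ x → *-distribʳ-sum (C x v) λ w → A u w * B w x) ⟨
  ((A ⊗ B) ⊗ C) u v ∎
  where open ≡-Reasoning

⊗-distribˡ-+ : ∀ {n} (A B C : Matrix n) u v →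
  (A ⊗ λ x y → B x y + C x y) u v ≡ (A ⊗ B) u v + (A ⊗ C) u v
⊗-distribˡ-+ A B C u v = trans (sum-cong-≗ λ w → *-distribˡ-+ (A u w) (B w v) (C w v))
  (∑-distrib-+ (λ w → A u w * B w v) λ w → A u w * C w v)

⊗-distribʳ-+ : ∀ {n} (A B C : Matrix n) u v →
  ((λ x y → B x y + C x y) ⊗ A) u v ≡ (B ⊗ A) u v + (C ⊗ A) u v
⊗-distribʳ-+ A B C u v = trans (sum-cong-≗ λ w → *-distribʳ-+ (A w v) (B u w) (C u w))
  (∑-distrib-+ (λ w → B u w * A w v) λ w → C u w * A w v)

⊗-rowsum : ∀ {n} (A B : Matrix n) {b} → (∀ w → sum (B w) ≡ b) → ∀ u → sum ((A ⊗ B) u) ≡ sum (A u) * b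
⊗-rowsum A B {b} rows u = begin
  sum ((A ⊗ B) u)
    ≡⟨ ∑-comm (λ v w → A u w * B w v) ⟩
  ∑[ w < _ ] ∑[ v < _ ] (A u w * B w v)
    ≡⟨ (sum-cong-≗ λ w → *-distribˡ-sum (A u w) (B w)) ⟨
  ∑[ w < _ ] (A u w * sum (B w))
    ≡⟨ (sum-cong-≗ λ w → cong (A u w *_) (rows w)) ⟩
  ∑[ w < _ ] (A u w * b)
    ≡⟨ *-distribʳ-sum b (A u) ⟨
  sum (A u) * b ∎
  where open ≡-Reasoning

trace : ∀ {n} → Matrix n → ℕ
trace {n} A = ∑[ u < n ] A u u

infixr 8 _^^_
_^^_ : ∀ {n} → Matrix n → ℕ → Matrix n
A ^^ zero  = Id
A ^^ suc j = A ⊗ A ^^ j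

module _ {n} (A : Matrix n) where

  powerSum : ℕ → Matrix n
  powerSum zero    u v = Id u v
  powerSum (suc k) u v = powerSum k u v + (A ^^ suc k) u v

  ^^-comm : ∀ j u v → (A ⊗ A ^^ j) u v ≡ (A ^^ j ⊗ A) u v
  ^^-comm zero    u v = trans (⊗-identityʳ A u v) (sym (⊗-identityˡ A u v))
  ^^-comm (suc j) u v = trans (⊗-congʳ A (A ⊗ A ^^ j) (A ^^ j ⊗ A) (^^-comm j) u v) (⊗-assoc A (A ^^ j) A u v)

  -- Lets the same product be bounded by out-degrees in one order and by in-degrees in the other.
  powerSum-comm : ∀ k u v → (A ⊗ powerSum k) u v ≡ (powerSum k ⊗ A) u v
  powerSum-comm zero    u v = ^^-comm zero u v
  powerSum-comm (suc k) u v = trans (⊗-distribˡ-+ A (powerSum k) (A ^^ suc k) u v)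
    (trans (cong₂ _+_ (powerSum-comm k u v) (^^-comm (suc k) u v))
      (sym (⊗-distribʳ-+ A (powerSum k) (A ^^ suc k) u v)))

  -- The definition splits off the highest power; this splits off the first edge of a walk instead,
  -- which suits induction on walks.
  powerSum-unfold : ∀ k u v → powerSum (suc k) u v ≡ Id u v + (A ⊗ powerSum k) u v
  powerSum-unfold zero    u v = refl
  powerSum-unfold (suc k) u v = begin
    powerSum (suc k) u v + (A ^^ suc (suc k)) u v
      ≡⟨ cong (_+ (A ^^ suc (suc k)) u v) (powerSum-unfold k u v) ⟩
    Id u v + (A ⊗ powerSum k) u v + (A ^^ suc (suc k)) u v
      ≡⟨ +-assoc (Id u v) ((A ⊗ powerSum k) u v) ((A ^^ suc (suc k)) u v) ⟩
    Id u v + ((A ⊗ powerSum k) u v + (A ^^ suc (suc k)) u v)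
      ≡⟨ cong (Id u v +_) (⊗-distribˡ-+ A (powerSum k) (A ^^ suc k) u v) ⟨
    Id u v + (A ⊗ powerSum (suc k)) u v ∎
    where open ≡-Reasoning

  -- Closed walks as cyclic words.

  walkWeight : ∀ {q} → Fin n → Vec (Fin n) q → Fin n → ℕ
  walkWeight x []      y = A x y
  walkWeight x (z ∷ w) y = A x z * walkWeight z w y

  -- The word lists interior vertices only, so `q` letters account for `suc q` edges.
  ∑ʷ-walkWeight : ∀ q x y → ∑ʷ q (λ w → walkWeight x w y) ≡ (A ^^ suc q) x y
  ∑ʷ-walkWeight zero    x y = sym (⊗-identityʳ A x y)
  ∑ʷ-walkWeight (suc q) x y = sum-cong-≗ λ z → trans
    (sym (*-distribˡ-∑ʷ q (A x z) λ w → walkWeight z w y))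
    (cong (A x z *_) (∑ʷ-walkWeight q z y))

  walkWeight-∷ʳ : ∀ {q} x (w : Vec (Fin n) q) z y →
    walkWeight x (w ∷ʳ z) y ≡ walkWeight x w z * A z y
  walkWeight-∷ʳ x []      z y = refl
  walkWeight-∷ʳ x (t ∷ w) z y = trans (cong (A x t *_) (walkWeight-∷ʳ t w z y))
    (sym (*-assoc (A x t) (walkWeight t w z) (A z y)))

  cycleWeight : ∀ {q} → Vec (Fin n) (suc q) → ℕ
  cycleWeight (x ∷ w) = walkWeight x w x

  cycleWeight-rotate : ∀ {q} (w : Vec (Fin n) (suc q)) → cycleWeight (rotate w) ≡ cycleWeight w
  cycleWeight-rotate (x ∷ [])    = refl
  cycleWeight-rotate (x ∷ z ∷ w) = trans (walkWeight-∷ʳ z w x z) (*-comm (walkWeight z w x) (A x z))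

  -- The trace sums `cycleWeight` over all words of length `p`. A constant word repeats a loop, so
  -- its weight is 0 and only the multiple of `p` remains.
  prime∣trace-^^ : ∀ {p} → Prime p → (∀ x → A x x ≡ 0) → p ∣ trace (A ^^ p)
  prime∣trace-^^ {zero}  pr _ = contradiction pr ¬prime[0]
  prime∣trace-^^ {suc q} pr loopless with ∑ʷ-fermat pr cycleWeight cycleWeight-rotate
  ... | e , eq = divides e (begin
    trace (A ^^ suc q)
      ≡⟨ (sum-cong-≗ λ x → ∑ʷ-walkWeight q x x) ⟨
    ∑ʷ (suc q) cycleWeight
      ≡⟨ eq ⟩
    e * suc q + ∑[ x < n ] cycleWeight (replicate (suc q) x)
      ≡⟨ cong (e * suc q +_) (sum-zero (constant q)) ⟩
    e * suc q + 0
      ≡⟨ +-identityʳ (e * suc q) ⟩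
    e * suc q ∎)
    where
    open ≡-Reasoning
    constant : ∀ q x → cycleWeight (replicate (suc q) x) ≡ 0
    constant zero    x = loopless x
    constant (suc q) x = cong (_* walkWeight x (replicate q x) x) (loopless x)

-- With weight 1 on an alphabet of `a` letters there are `a ^ p` words, of which `a` are constant.
fermat : ∀ {p} → Prime p → ∀ a → ∃ λ e → a ^ p ≡ e * p + a
fermat {zero}  pr a = contradiction pr ¬prime[0]
fermat {suc q} pr a with ∑ʷ-fermat {a} pr (λ _ → 1) (λ _ → refl)
... | e , eq = e , (begin
  a ^ suc q                     ≡⟨ *-identityʳ (a ^ suc q) ⟨
  a ^ suc q * 1                 ≡⟨ ∑ʷ-const {a} (suc q) 1 ⟨
  ∑ʷ {a} (suc q) (λ _ → 1)      ≡⟨ eq ⟩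
  e * suc q + ∑[ x < a ] 1      ≡⟨ cong (e * suc q +_) (trans (sum-const a 1) (*-identityʳ a)) ⟩
  e * suc q + a                 ∎)
  where open ≡-Reasoning

-- Powers of two.

n<2^n : ∀ n → n < 2 ^ n
n<2^n zero    = ≤-refl
n<2^n (suc n) = +-mono-≤ (m^n>0 2 n) (≤-trans (n<2^n n) (m≤m+n (2 ^ n) 0))

^-geometric : ∀ k → 2 ^ suc k ≡ M 2 k + 1
^-geometric zero    = refl
^-geometric (suc k) = trans (cong (λ x → 2 ^ suc k + (x + 0)) (^-geometric k))
  (rearrange (2 ^ suc k) (M 2 k))
  where
  rearrange : ∀ x y → x + (y + 1 + 0) ≡ y + x + 1
  rearrange = solve-∀

-- Walks and matrix entries in a geodetic digraph.

sum-≢0 : ∀ {n} (f : Fin n → ℕ) → sum f ≢ 0 → ∃ λ i → f i ≢ 0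
sum-≢0 {zero}  f nz = contradiction refl nz
sum-≢0 {suc n} f nz with f zero ≟ 0
... | no  f₀≢0 = zero , f₀≢0
... | yes f₀≡0 with sum-≢0 (f ∘ suc) (nz ∘ cong₂ _+_ f₀≡0)
...   | i , fᵢ≢0 = suc i , fᵢ≢0

sum-≤1 : ∀ {n} (f : Fin n → ℕ) → (∀ i → f i ≤ 1) → (∀ i j → f i ≢ 0 → f j ≢ 0 → i ≡ j) → sum f ≤ 1
sum-≤1 {zero}  f f≤1 unique = z≤n
sum-≤1 {suc n} f f≤1 unique with f zero ≟ 0
... | yes f₀≡0 rewrite f₀≡0 =
  sum-≤1 (f ∘ suc) (f≤1 ∘ suc) λ i j nzᵢ nzⱼ → Fin.suc-injective (unique (suc i) (suc j) nzᵢ nzⱼ)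
... | no  f₀≢0 = subst (_≤ 1) (sym (sum-single zero others)) (f≤1 zero)
  where
  others : ∀ i → i ≢ zero → f i ≡ 0
  others i i≢0 with f i ≟ 0
  ... | yes eq = eq
  ... | no  nz = contradiction (unique i zero nz f₀≢0) i≢0

module _ {n} (G : Digraph n) where

  adjacency : Matrix n
  adjacency u v = if G u v then 1 else 0

  adjacency≤1 : ∀ u v → adjacency u v ≤ 1
  adjacency≤1 u v with G u v
  ... | true  = ≤-refl
  ... | false = z≤n

  adjacency⇒edge : ∀ u v → adjacency u v ≢ 0 → T (G u v)
  adjacency⇒edge u v nz with G u v
  ... | true  = _
  ... | false = contradiction refl nz

  -- A nonzero sum has a nonzero term, whose factors give the first edge and the rest of the walk.
  power⇒walk : ∀ j u v → (adjacency ^^ j) u v ≢ 0 → Walk G u v j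
  power⇒walk zero u v nz with u Fin.≟ v
  ... | yes refl = stop
  ... | no  _    = contradiction refl nz
  power⇒walk (suc j) u v nz with sum-≢0 (λ w → adjacency u w * (adjacency ^^ j) w v) nz
  ... | w , nz′ = step
    (adjacency⇒edge u w λ eq → nz′ (cong (_* (adjacency ^^ j) w v) eq))
    (power⇒walk j w v λ eq → nz′ (trans (cong (adjacency u w *_) eq) (*-zeroʳ (adjacency u w))))

  powerSum⇒walk : ∀ k u v → powerSum adjacency k u v ≢ 0 → ∃ λ ℓ → ℓ ≤ k × Walk G u v ℓ
  powerSum⇒walk zero    u v nz = zero , z≤n , power⇒walk zero u v nz
  powerSum⇒walk (suc k) u v nz with powerSum adjacency k u v ≟ 0
  ... | yes eq = suc k , ≤-refl ,
    power⇒walk (suc k) u v λ eq′ → nz (cong₂ _+_ eq eq′)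
  ... | no  nz′ with powerSum⇒walk k u v nz′
  ...   | ℓ , ℓ≤k , w = ℓ , m≤n⇒m≤1+n ℓ≤k , w

  -- Serves to read off equality of first steps from equality of walks paired with their lengths.
  -- The empty walk gets its own vertex as default value.
  second : ∀ {u v} → ∃ (Walk G u v) → Fin n
  second {u} (_ , stop)           = u
  second     (_ , step {w = w} _ _) = w

  -- Induction by first edge: two different first steps would start two different short walks to
  -- `v`, so at most one term of the sum survives. If `u` is `v`, the empty walk already excludes
  -- every such term.
  powerSum≤1 : ∀ k → KGeodetic k G → ∀ u v → powerSum adjacency k u v ≤ 1
  powerSum≤1 zero    geo u v with u Fin.≟ v
  ... | yes _ = ≤-refl
  ... | no  _ = z≤n
  powerSum≤1 (suc k) geo u v = subst (_≤ 1) (sym (powerSum-unfold adjacency k u v)) bound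
    where
    f : Fin n → ℕ
    f w = adjacency u w * powerSum adjacency k w v

    walk-via : ∀ w → f w ≢ 0 → ∃ λ ℓ → ℓ ≤ k × T (G u w) × Walk G w v ℓ
    walk-via w nz with powerSum⇒walk k w v (λ eq → nz (trans (cong (adjacency u w *_) eq) (*-zeroʳ (adjacency u w))))
    ... | ℓ , ℓ≤k , p = ℓ , ℓ≤k , adjacency⇒edge u w (λ eq → nz (cong (_* powerSum adjacency k w v) eq)) , p

    unique : ∀ i j → f i ≢ 0 → f j ≢ 0 → i ≡ j
    unique i j nzᵢ nzⱼ with walk-via i nzᵢ | walk-via j nzⱼ
    ... | ℓ , ℓ≤k , e , p | ℓ′ , ℓ′≤k , e′ , p′ =
      cong second (geo u v (suc ℓ) (suc ℓ′) (step e p) (step e′ p′) (s≤s ℓ≤k) (s≤s ℓ′≤k))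

    geo′ : KGeodetic k G
    geo′ u v ℓ ℓ′ p q ℓ≤k ℓ′≤k = geo u v ℓ ℓ′ p q (m≤n⇒m≤1+n ℓ≤k) (m≤n⇒m≤1+n ℓ′≤k)

    bound : Id u v + sum f ≤ 1
    bound with u Fin.≟ v
    ... | no  _ = sum-≤1 f (λ w → *-mono-≤ (adjacency≤1 u w) (powerSum≤1 k geo′ w v)) unique
    ... | yes refl with sum f ≟ 0
    ...   | yes eq = ≤-reflexive (cong suc eq)
    ...   | no  nz with sum-≢0 f nz
    ...     | w , nz′ with walk-via w nz′
    ...       | ℓ , ℓ≤k , e , p = contradiction
      (cong proj₁ (geo u u 0 (suc ℓ) stop (step e p) z≤n (s≤s ℓ≤k))) λ ()

  -- A closed walk of positive length at most `k` would compete with the empty walk.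
  no-short-cycle : ∀ k → KGeodetic k G → ∀ {j} → 0 < j → j ≤ k → ∀ u → (adjacency ^^ j) u u ≡ 0
  no-short-cycle k geo {j} 0<j j≤k u with (adjacency ^^ j) u u ≟ 0
  ... | yes eq = eq
  ... | no  nz = contradiction
    (cong proj₁ (geo u u 0 j stop (power⇒walk j u u nz) z≤n j≤k)) (<⇒≢ 0<j)

-- List counts as finite sums.

sum-map-tabulate : ∀ {n} {A : Set} (f : A → ℕ) (g : Fin n → A) → ListAction.sum (map f (tabulate g)) ≡ sum (f ∘ g)
sum-map-tabulate {zero}  f g = refl
sum-map-tabulate {suc n} f g = cong (f (g zero) +_) (sum-map-tabulate f (g ∘ suc))

length-filter-tabulate : ∀ {n} {A : Set} {P : A → Set} (P? : ∀ x → Dec (P x)) (g : Fin n → A) →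
  length (filter P? (tabulate g)) ≡ ∑[ i < n ] 𝟙 (P? (g i))
length-filter-tabulate {zero}  P? g = refl
length-filter-tabulate {suc n} P? g with does (P? (g zero))
... | true  = cong suc (length-filter-tabulate P? (g ∘ suc))
... | false = length-filter-tabulate P? (g ∘ suc)

-- Consequences of the in-degree sequence.

module _ (k : ℕ) (G : Digraph (M 2 k + 2)) (geo : KGeodetic k G)
  (out≥2 : ∀ u → 2 ≤ outdeg G u)
  (in∈ : ∀ v → indeg G v ≡ 1 ⊎ indeg G v ≡ 2 ⊎ indeg G v ≡ 3)
  (#1≡4 : numInDeg G 1 ≡ 4) (#3≡4 : numInDeg G 3 ≡ 4)
  where

  private
    n = M 2 k + 2
    A = adjacency G

  #indeg : ∀ d → ∑[ v < n ] 𝟙 (indeg G v ≟ d) ≡ numInDeg G d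
  #indeg d = sym (length-filter-tabulate (λ v → indeg G v ≟ d) (λ v → v))

  outdeg-sum : ∀ u → sum (A u) ≡ outdeg G u
  outdeg-sum u = sym (sum-map-tabulate (λ v → A u v) (λ v → v))

  indeg-sum : ∀ v → ∑[ u < n ] A u v ≡ indeg G v
  indeg-sum v = sym (sum-map-tabulate (λ u → A u v) (λ v → v))

  -- The four vertices of in-degree 1 and the four of in-degree 3 balance around the average 2.
  ∑indeg : ∑[ v < n ] indeg G v ≡ n * 2
  ∑indeg = +-cancelʳ-≡ 4 _ _ (begin
    ∑[ v < n ] indeg G v + 4
      ≡⟨ cong (∑[ v < n ] indeg G v +_) (trans (#indeg 1) #1≡4) ⟨
    ∑[ v < n ] indeg G v + ∑[ v < n ] 𝟙 (indeg G v ≟ 1)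
      ≡⟨ ∑-distrib-+ (indeg G) (λ v → 𝟙 (indeg G v ≟ 1)) ⟨
    ∑[ v < n ] (indeg G v + 𝟙 (indeg G v ≟ 1))
      ≡⟨ sum-cong-≗ balance ⟩
    ∑[ v < n ] (2 + 𝟙 (indeg G v ≟ 3))
      ≡⟨ ∑-distrib-+ (λ (v : Fin n) → 2) (λ v → 𝟙 (indeg G v ≟ 3)) ⟩
    ∑[ v < n ] 2 + ∑[ v < n ] 𝟙 (indeg G v ≟ 3)
      ≡⟨ cong₂ _+_ (sum-const n 2) (trans (#indeg 3) #3≡4) ⟩
    n * 2 + 4 ∎)
    where
    open ≡-Reasoning
    balance : ∀ v → indeg G v + 𝟙 (indeg G v ≟ 1) ≡ 2 + 𝟙 (indeg G v ≟ 3)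
    balance v with indeg G v | in∈ v
    ... | _ | inj₁ refl        = refl
    ... | _ | inj₂ (inj₁ refl) = refl
    ... | _ | inj₂ (inj₂ refl) = refl

  -- Counting edges by heads gives `n * 2` in all, so the lower bound 2 is attained at every tail.
  out≡2 : ∀ u → sum (A u) ≡ 2
  out≡2 u = sym (sum-mono-≡ (λ u → subst (2 ≤_) (sym (outdeg-sum u)) (out≥2 u))
    (≤-reflexive (begin
      ∑[ u < n ] sum (A u)           ≡⟨ ∑-comm A ⟩
      ∑[ v < n ] ∑[ u < n ] A u v    ≡⟨ sum-cong-≗ indeg-sum ⟩
      ∑[ v < n ] indeg G v           ≡⟨ ∑indeg ⟩
      n * 2                          ≡⟨ sum-const n 2 ⟨
      ∑[ u < n ] 2                   ∎)) u)
    where open ≡-Reasoning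

  power-rowsum : ∀ j u → sum ((A ^^ j) u) ≡ 2 ^ j
  power-rowsum zero    u = trans (sum-single u λ v v≢u → 𝟙-false (u Fin.≟ v) (v≢u ∘ sym))
    (𝟙-true (u Fin.≟ u) refl)
  power-rowsum (suc j) u = trans (⊗-rowsum A (A ^^ j) (power-rowsum j) u)
    (cong (_* 2 ^ j) (out≡2 u))

  powerSum-rowsum : ∀ j u → sum (powerSum A j u) ≡ M 2 j
  powerSum-rowsum zero    u = power-rowsum 0 u
  powerSum-rowsum (suc j) u = trans (∑-distrib-+ (powerSum A j u) ((A ^^ suc j) u))
    (cong₂ _+_ (powerSum-rowsum j u) (power-rowsum (suc j) u))

  ω : Fin n → ℕ
  ω v = 2 ⊓ indeg G v

  -- Capping at 2 leaves a deficit of 1 at exactly four vertices, and this 4 is twice the excess of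
  -- the order over `M 2 k`.
  ∑ω : sum ω ≡ 2 * M 2 k
  ∑ω = +-cancelʳ-≡ 4 _ _ (begin
    sum ω + 4
      ≡⟨ cong (sum ω +_) (trans (#indeg 1) #1≡4) ⟨
    sum ω + ∑[ v < n ] 𝟙 (indeg G v ≟ 1)
      ≡⟨ ∑-distrib-+ ω (λ v → 𝟙 (indeg G v ≟ 1)) ⟨
    ∑[ v < n ] (ω v + 𝟙 (indeg G v ≟ 1))
      ≡⟨ sum-cong-≗ deficit ⟩
    ∑[ v < n ] 2
      ≡⟨ sum-const n 2 ⟩
    (M 2 k + 2) * 2
      ≡⟨ expand (M 2 k) ⟩
    2 * M 2 k + 4 ∎)
    where
    open ≡-Reasoning
    deficit : ∀ v → ω v + 𝟙 (indeg G v ≟ 1) ≡ 2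
    deficit v with indeg G v | in∈ v
    ... | _ | inj₁ refl        = refl
    ... | _ | inj₂ (inj₁ refl) = refl
    ... | _ | inj₂ (inj₂ refl) = refl
    expand : ∀ x → (x + 2) * 2 ≡ 2 * x + 4
    expand = solve-∀

  -- As `powerSum A k` has entries at most 1, the row sum of `A` bounds an entry by 2 and, after
  -- commuting the factors, the column sum bounds it by the in-degree. Row totals equal `sum ω`, so
  -- the smaller bound is attained.
  A⊗powerSum≡ω : ∀ u v → (A ⊗ powerSum A k) u v ≡ ω v
  A⊗powerSum≡ω u = sum-mono-≡ (λ v → ⊓-glb (≤2 v) (≤indeg v)) (≤-reflexive
    (trans ∑ω (sym (trans (⊗-rowsum A (powerSum A k) (powerSum-rowsum k) u)
      (cong (_* M 2 k) (out≡2 u))))))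
    where
    ≤2 : ∀ v → (A ⊗ powerSum A k) u v ≤ 2
    ≤2 v = subst ((A ⊗ powerSum A k) u v ≤_) (out≡2 u)
      (sum-mono-≤ λ w → subst (A u w * powerSum A k w v ≤_) (*-identityʳ (A u w))
        (*-monoʳ-≤ (A u w) (powerSum≤1 G k geo w v)))
    ≤indeg : ∀ v → (A ⊗ powerSum A k) u v ≤ indeg G v
    ≤indeg v = subst₂ _≤_ (sym (powerSum-comm A k u v)) (indeg-sum v)
      (sum-mono-≤ λ w → subst (powerSum A k u w * A w v ≤_) (*-identityˡ (A w v))
        (*-monoˡ-≤ (A w v) (powerSum≤1 G k geo u w)))

  -- Recurrences for powers and traces.

  power-telescope : ∀ u v → (A ^^ (2 + k)) u v ≡ (A ^^ 1) u v + ω v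
  -- `A ⊗ powerSum A (suc k)` is evaluated twice, splitting off its highest power and splitting off
  -- the identity; one copy of `ω v` then cancels.
  power-telescope u v = +-cancelˡ-≡ (ω v) _ _ (begin
    ω v + (A ^^ (2 + k)) u v
      ≡⟨ cong (_+ (A ^^ (2 + k)) u v) (A⊗powerSum≡ω u v) ⟨
    (A ⊗ powerSum A k) u v + (A ^^ (2 + k)) u v
      ≡⟨ ⊗-distribˡ-+ A (powerSum A k) (A ^^ suc k) u v ⟨
    (A ⊗ powerSum A (suc k)) u v
      ≡⟨ ⊗-congʳ A (powerSum A (suc k)) (λ w v → Id w v + ω v)
           (λ w v → trans (powerSum-unfold A k w v) (cong (Id w v +_) (A⊗powerSum≡ω w v))) u v ⟩
    (A ⊗ λ w v → Id w v + ω v) u v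
      ≡⟨ ⊗-distribˡ-+ A Id (λ _ v → ω v) u v ⟩
    (A ^^ 1) u v + ∑[ w < n ] (A u w * ω v)
      ≡⟨ cong ((A ^^ 1) u v +_) (*-distribʳ-sum (ω v) (A u)) ⟨
    (A ^^ 1) u v + sum (A u) * ω v
      ≡⟨ cong (λ d → (A ^^ 1) u v + d * ω v) (out≡2 u) ⟩
    (A ^^ 1) u v + 2 * ω v
      ≡⟨ rearrange ((A ^^ 1) u v) (ω v) ⟩
    ω v + ((A ^^ 1) u v + ω v) ∎)
    where
    open ≡-Reasoning
    rearrange : ∀ x y → x + 2 * y ≡ y + (x + y)
    rearrange = solve-∀

  -- Each factor `A` doubles the matrix whose rows are all `ω`, as the rows of `A` sum to 2. The
  -- exponent is `suc i` plus the period `suc k`.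
  power-period : ∀ i u v → (A ^^ (i + (2 + k))) u v ≡ (A ^^ suc i) u v + 2 ^ i * ω v
  power-period zero    u v = trans (power-telescope u v)
    (cong ((A ^^ 1) u v +_) (sym (*-identityˡ (ω v))))
  power-period (suc i) u v = begin
    (A ^^ (suc i + (2 + k))) u v
      ≡⟨ ⊗-congʳ A (A ^^ (i + (2 + k))) (λ w v → (A ^^ suc i) w v + 2 ^ i * ω v) (power-period i) u v ⟩
    (A ⊗ λ w v → (A ^^ suc i) w v + 2 ^ i * ω v) u v
      ≡⟨ ⊗-distribˡ-+ A (A ^^ suc i) (λ _ v → 2 ^ i * ω v) u v ⟩
    (A ^^ (2 + i)) u v + ∑[ w < n ] (A u w * (2 ^ i * ω v))
      ≡⟨ cong ((A ^^ (2 + i)) u v +_) (*-distribʳ-sum (2 ^ i * ω v) (A u)) ⟨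
    (A ^^ (2 + i)) u v + sum (A u) * (2 ^ i * ω v)
      ≡⟨ cong (λ d → (A ^^ (2 + i)) u v + d * (2 ^ i * ω v)) (out≡2 u) ⟩
    (A ^^ (2 + i)) u v + 2 * (2 ^ i * ω v)
      ≡⟨ cong ((A ^^ (2 + i)) u v +_) (*-assoc 2 (2 ^ i) (ω v)) ⟨
    (A ^^ (2 + i)) u v + 2 ^ suc i * ω v ∎
    where open ≡-Reasoning

  -- The `ω` term has trace `2 ^ i * sum ω`, a difference of powers of two because `M 2 k + 1` is
  -- `2 ^ suc k`. The additive form avoids truncated subtraction.
  trace-period : ∀ i → trace (A ^^ (suc i + suc k)) + 2 ^ suc i ≡ trace (A ^^ suc i) + 2 ^ (suc i + suc k)
  trace-period i = begin
    trace (A ^^ (suc i + suc k)) + 2 ^ suc i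
      ≡⟨ cong (λ j → trace (A ^^ j) + 2 ^ suc i) (+-suc i (suc k)) ⟨
    trace (A ^^ (i + (2 + k))) + 2 ^ suc i
      ≡⟨ cong (_+ 2 ^ suc i) (trans (sum-cong-≗ λ u → power-period i u u)
           (∑-distrib-+ (λ u → (A ^^ suc i) u u) (λ u → 2 ^ i * ω u))) ⟩
    trace (A ^^ suc i) + ∑[ u < n ] (2 ^ i * ω u) + 2 ^ suc i
      ≡⟨ cong (λ s → trace (A ^^ suc i) + s + 2 ^ suc i)
           (trans (sym (*-distribˡ-sum (2 ^ i) ω)) (cong (2 ^ i *_) ∑ω)) ⟩
    trace (A ^^ suc i) + 2 ^ i * (2 * M 2 k) + 2 ^ suc i
      ≡⟨ rearrange (trace (A ^^ suc i)) (2 ^ i) (M 2 k) ⟩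
    trace (A ^^ suc i) + 2 * 2 ^ i * (M 2 k + 1)
      ≡⟨ cong (λ x → trace (A ^^ suc i) + 2 ^ suc i * x) (^-geometric k) ⟨
    trace (A ^^ suc i) + 2 ^ suc i * 2 ^ suc k
      ≡⟨ cong (trace (A ^^ suc i) +_) (^-distribˡ-+-* 2 (suc i) (suc k)) ⟨
    trace (A ^^ suc i) + 2 ^ (suc i + suc k) ∎
    where
    open ≡-Reasoning
    rearrange : ∀ t x y → t + x * (2 * y) + 2 * x ≡ t + 2 * x * (y + 1)
    rearrange = solve-∀

  -- Induction on the number `t` of periods, starting from the absence of closed walks of length
  -- `c`.
  trace-power : ∀ c → 0 < c → c ≤ k → ∀ t →
    trace (A ^^ (c + t * suc k)) + 2 ^ c ≡ 2 ^ (c + t * suc k)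
  trace-power c 0<c c≤k zero rewrite +-identityʳ c =
    cong (_+ 2 ^ c) (sum-zero (no-short-cycle G k geo 0<c c≤k))
  -- Adding `2 ^ j` on both sides makes `trace-period` applicable; writing `c` as `suc c′` shows its
  -- exponent `j` to be a successor.
  trace-power c@(suc c′) 0<c c≤k (suc t) = +-cancelʳ-≡ (2 ^ j) _ _ (begin
    trace (A ^^ (c + (suc k + t * suc k))) + 2 ^ c + 2 ^ j
      ≡⟨ cong (λ e → trace (A ^^ e) + 2 ^ c + 2 ^ j) exponent ⟩
    trace (A ^^ (j + suc k)) + 2 ^ c + 2 ^ j
      ≡⟨ swap (trace (A ^^ (j + suc k))) (2 ^ c) (2 ^ j) ⟩
    trace (A ^^ (j + suc k)) + 2 ^ j + 2 ^ c
      ≡⟨ cong (_+ 2 ^ c) (trace-period (c′ + t * suc k)) ⟩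
    trace (A ^^ j) + 2 ^ (j + suc k) + 2 ^ c
      ≡⟨ swap (trace (A ^^ j)) (2 ^ (j + suc k)) (2 ^ c) ⟩
    trace (A ^^ j) + 2 ^ c + 2 ^ (j + suc k)
      ≡⟨ cong (_+ 2 ^ (j + suc k)) (trace-power c 0<c c≤k t) ⟩
    2 ^ j + 2 ^ (j + suc k)
      ≡⟨ +-comm (2 ^ j) (2 ^ (j + suc k)) ⟩
    2 ^ (j + suc k) + 2 ^ j
      ≡⟨ cong (λ e → 2 ^ e + 2 ^ j) exponent ⟨
    2 ^ (c + (suc k + t * suc k)) + 2 ^ j ∎)
    where
    open ≡-Reasoning
    j = c + t * suc k
    exponent : c + (suc k + t * suc k) ≡ j + suc k
    exponent = trans (cong (c +_) (+-comm (suc k) (t * suc k))) (sym (+-assoc c (t * suc k) (suc k)))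
    swap : ∀ x y z → x + y + z ≡ x + z + y
    swap = solve-∀

  -- The contradiction modulo a large prime.

  no-large-prime : 2 ≤ k → ∀ {p} → Prime p → 2 ^ suc k < p → p % suc k ≢ 1 → ⊥
  no-large-prime 2≤k {p} pr K<p p≢1 with
    prime∣trace-^^ A pr (λ x → trans (sym (⊗-identityʳ A x x)) (no-short-cycle G k geo (s≤s z≤n) (<⇒≤ 2≤k) x))
    | fermat pr 2
  -- Both `2 ^ c` and 2 are below `p`, so their congruence modulo `p` is an equality and forces `c`
  -- to be 1.
  ... | divides e trace≡ | e′ , 2^p≡ = p≢1 (2^c≡2⇒c≡1 (begin
    2 ^ c                 ≡⟨ m<n⇒m%n≡m 2^c<p ⟨
    2 ^ c % p             ≡⟨ [m+kn]%n≡m%n (2 ^ c) e p ⟨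
    (2 ^ c + e * p) % p   ≡⟨ cong (_% p) (trans (+-comm (2 ^ c) (e * p)) same) ⟩
    (e′ * p + 2) % p      ≡⟨ cong (_% p) (+-comm (e′ * p) 2) ⟩
    (2 + e′ * p) % p      ≡⟨ [m+kn]%n≡m%n 2 e′ p ⟩
    2 % p                 ≡⟨ m<n⇒m%n≡m (≤-<-trans (^-monoʳ-≤ 2 {1} {suc k} (s≤s z≤n)) K<p) ⟩
    2                     ∎))
    where
    open ≡-Reasoning
    instance
      p≢0 : NonZero p
      p≢0 = prime⇒nonZero pr

    c = p % suc k

    c≤k : c ≤ k
    c≤k = ≤-pred (m%n<n p (suc k))

    2^c<p : 2 ^ c < p
    2^c<p = ≤-<-trans (^-monoʳ-≤ 2 (m≤n⇒m≤1+n c≤k)) K<p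

    suc-k<p : suc k < p
    suc-k<p = <-trans (n<2^n (suc k)) K<p

    0<c : 0 < c
    -- A zero residue would make `suc k` a divisor of `p` different from 1 and from `p`.
    0<c = n≢0⇒n>0 λ c≡0 → [ (λ k≡0 → <⇒≢ (s≤s (<⇒≤ 2≤k)) (sym k≡0)) , <⇒≢ suc-k<p ]′
      (prime⇒irreducible pr (m%n≡0⇒n∣m p (suc k) c≡0))

    same : e * p + 2 ^ c ≡ e′ * p + 2
    same = begin
      e * p + 2 ^ c                                ≡⟨ cong (_+ 2 ^ c) trace≡ ⟨
      trace (A ^^ p) + 2 ^ c                       ≡⟨ cong (λ j → trace (A ^^ j) + 2 ^ c) p≡ ⟩
      trace (A ^^ (c + p / suc k * suc k)) + 2 ^ c ≡⟨ trace-power c 0<c c≤k (p / suc k) ⟩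
      2 ^ (c + p / suc k * suc k)                  ≡⟨ cong (2 ^_) p≡ ⟨
      2 ^ p                                        ≡⟨ 2^p≡ ⟩
      e′ * p + 2                                   ∎
      where
      p≡ = m≡m%n+[m/n]*n p (suc k)

    2^c≡2⇒c≡1 : ∀ {c} → 2 ^ c ≡ 2 → c ≡ 1
    2^c≡2⇒c≡1 {c} eq with <-cmp c 1
    ... | tri< c<1 _ _ = contradiction eq (<⇒≢ (^-monoʳ-< 2 ≤-refl c<1))
    ... | tri≈ _ c≡1 _ = c≡1
    ... | tri> _ _ 1<c = contradiction (sym eq) (<⇒≢ (^-monoʳ-< 2 ≤-refl 1<c))

theorem10 : (k : ℕ) → 2 ≤ k → (G : Digraph (M 2 k + 2)) →
    KGeodetic k G →
    (∀ u → 2 ≤ outdeg G u) →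
    (∀ v → indeg G v ≡ 1 ⊎ indeg G v ≡ 2 ⊎ indeg G v ≡ 3) →
    numInDeg G 1 ≡ 4 → numInDeg G 3 ≡ 4 →
    ⊥
-- From `2 ≤ k` the modulus `suc k` exceeds 2, as the choice of the prime requires.
theorem10 k 2≤k G geo out≥2 in∈ #1≡4 #3≡4 with large-prime≢1-mod (suc k) (2 ^ suc k) (s≤s 2≤k)
... | p , pr , K<p , p≢1 = no-large-prime k G geo out≥2 in∈ #1≡4 #3≡4 2≤k pr K<p p≢1
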